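{- Let $n>1$ be an integer, let $K$ be an arbitrary group of order $n$ with identity element $e_K$, and let $H=S_2\wr K$ be the wreath product, whose elements are the triples $(g;k_1,k_2)$ with $g\in S_2$, $k_1,k_2\in K$, with multiplication $(g;k_1,k_2)(g';k'_1,k'_2)=(gg';\,k_1k'_{1^g},\,k_2k'_{2^g})$. Let $e$ denote the identity of $S_2$ and $\pi=(1,2)$ the transposition in $S_2$, and put $$A=\{(e;u,u): u\in K,\ u\neq e_K\},\quad B=\{(e;e_K,u): u\in K,\ u\neq e_K\},\quad C=\{(\pi;u,e_K): u\in K\}.$$ Let $X=A\cup B\cup C$. Then the Cayley digraph $\mathrm{Cay}(H,X)$ is a directed strongly regular graph with parameter set $(2n^2,\,3n-2,\,2n-1,\,n-1,\,3)$.
   Context: $S_2$ is the symmetric group on $\{1,2\}$, and $1^g,2^g$ denote the images of $1,2$ under $g\in S_2$. For a finite group $H$ and a subset $X\subseteq H$ not containing the identity, the Cayley digraph $\mathrm{Cay}(H,X)$ has vertex set $H$ and dart (arc) set $\{(x,y): x,y\in H,\ yx^{ -1}\in X\}$. A directed strongly regular graph (DSRG) with parameter set $(N,k,t,\lambda,\mu)$ (in this order) is a loopless directed graph on $N$ vertices that is regular of valency $k$ (every vertex has in-degree and out-degree $k$), such that every vertex is incident with exactly $t$ undirected edges (an undirected edge is a pair of opposite arcs), and for any two distinct vertices $x,y$ the number of directed paths of length 2 from $x$ to $y$ is $\lambda$ if there is an arc from $x$ to $y$ and $\mu$ otherwise. Equivalently, its adjacency matrix $A$ (with zero diagonal) satisfies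 $AJ=JA=kJ$ and $A^2=tI+\lambda A+\mu(J-I-A)$, where $J$ is the all-one matrix and $I$ the identity matrix. -}

module Defs where

open import Algebra.Bundles using (Group)
open import Data.Fin.Base using (Fin)
open import Data.Fin.Patterns using (0F; 1F)
open import Data.Fin.Permutation as Perm
  using (Permutation′; _⟨$⟩ʳ_; _⟨$⟩ˡ_; _∘ₚ_; transpose)
open import Data.Nat.Base using (ℕ)
open import Data.Product.Base using (Σ; ∃; _×_; _,_; proj₁)
open import Data.Sum.Base using (inj₁; inj₂)
open import Function.Bundles using (Inverse)
open import Level using (Level; _⊔_; suc)
open import Relation.Binary.Bundles using (Setoid)
open import Relation.Binary.Core using (Rel)
open import Relation.Binary.Definitions using (_Respects_; _Respects₂_)
import Relation.Binary.Construct.On as On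
import Relation.Binary.PropositionalEquality as ≡
import Relation.Binary.Reasoning.Setoid as SetoidReasoning
open import Relation.Nullary.Negation.Core using (¬_)
open import Relation.Unary using (Pred; _∈_; _∪_)

private
  variable
    a ℓ p : Level

HasSize : Setoid a ℓ → ℕ → Set (a ⊔ ℓ)
HasSize S n = Inverse S (≡.setoid (Fin n))

-- Membership proofs are ignored by the equality, so that the size of
-- `S ↾ P` counts elements of S and not the ways in which they satisfy P.

_↾_ : (S : Setoid a ℓ) → Pred (Setoid.Carrier S) p → Setoid (a ⊔ p) ℓ
S ↾ P = On.setoid {B = Σ (Setoid.Carrier S) P} S proj₁

record Subset (S : Setoid a ℓ) p : Set (a ⊔ ℓ ⊔ suc p) where
  open Setoid S
  field
    members : Pred Carrier p
    resp    : members Respects _≈_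

record Digraph a ℓ p : Set (suc (a ⊔ ℓ ⊔ p)) where
  field
    vertices : Setoid a ℓ

  open Setoid vertices public using (_≈_) renaming (Carrier to Vertex)

  field
    Arc      : Rel Vertex p
    Arc-resp : Arc Respects₂ _≈_

record IsDSRG (Γ : Digraph a ℓ p) (N k t lam μ : ℕ) : Set (a ⊔ ℓ ⊔ p) where
  open Digraph Γ
  field
    order      : HasSize vertices N
    loopless   : ∀ x → ¬ Arc x x
    out-degree : ∀ x → HasSize (vertices ↾ λ y → Arc x y) k
    in-degree  : ∀ x → HasSize (vertices ↾ λ y → Arc y x) k
    undirected : ∀ x → HasSize (vertices ↾ λ y → Arc x y × Arc y x) t
    paths-arc  : ∀ x y → ¬ x ≈ y → Arc x y →
                 HasSize (vertices ↾ λ z → Arc x z × Arc z y) lam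
    paths-¬arc : ∀ x y → ¬ x ≈ y → ¬ Arc x y →
                 HasSize (vertices ↾ λ z → Arc x z × Arc z y) μ

Cay : (H : Group a ℓ) → Subset (Group.setoid H) p → Digraph a ℓ p
Cay H X = record
  { vertices = setoid
  ; Arc      = λ x y → y ∙ x ⁻¹ ∈ members
  ; Arc-resp = (λ y≈y′ → resp (∙-congʳ y≈y′))
             , (λ x≈x′ → resp (∙-congˡ (⁻¹-cong x≈x′)))
  }
  where
  open Group H
  open Subset X

-- The points 1, 2 are 0F, 1F, and the image i^g is `g ⟨$⟩ʳ i`.  Since
-- `g ∘ₚ h` applies g first, it is the product gh for this right action.

module Wreath (K : Group a ℓ) where
  open Group K

  Triple : Set a
  Triple = Permutation′ 2 × Carrier × Carrier

  _≈ʷ_ : Rel Triple ℓ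
  (g , k₁ , k₂) ≈ʷ (h , l₁ , l₂) = g Perm.≈ h × k₁ ≈ l₁ × k₂ ≈ l₂

  nth : Carrier × Carrier → Fin 2 → Carrier
  nth (k₁ , k₂) 0F = k₁
  nth (k₁ , k₂) 1F = k₂

  _∙ʷ_ : Triple → Triple → Triple
  (g , k₁ , k₂) ∙ʷ (h , l) =
    g ∘ₚ h , k₁ ∙ nth l (g ⟨$⟩ʳ 0F) , k₂ ∙ nth l (g ⟨$⟩ʳ 1F)

  εʷ : Triple
  εʷ = Perm.id , ε , ε

  _⁻¹ʷ : Triple → Triple
  (g , k) ⁻¹ʷ = Perm.flip g , nth k (g ⟨$⟩ˡ 0F) ⁻¹ , nth k (g ⟨$⟩ˡ 1F) ⁻¹

  private
    open SetoidReasoning setoid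

    nth-cong : ∀ {k₁ k₂ l₁ l₂ i j} → k₁ ≈ l₁ → k₂ ≈ l₂ → i ≡.≡ j →
               nth (k₁ , k₂) i ≈ nth (l₁ , l₂) j
    nth-cong {i = 0F} p q ≡.refl = p
    nth-cong {i = 1F} p q ≡.refl = q

    nth-∙ : ∀ (g : Permutation′ 2) k₁ k₂ l i →
            nth (k₁ ∙ nth l (g ⟨$⟩ʳ 0F) , k₂ ∙ nth l (g ⟨$⟩ʳ 1F)) i
              ≈ nth (k₁ , k₂) i ∙ nth l (g ⟨$⟩ʳ i)
    nth-∙ g k₁ k₂ l 0F = refl
    nth-∙ g k₁ k₂ l 1F = refl

    nth-⁻¹ : ∀ (g : Permutation′ 2) k i →
             nth (nth k (g ⟨$⟩ˡ 0F) ⁻¹ , nth k (g ⟨$⟩ˡ 1F) ⁻¹) i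
               ≈ nth k (g ⟨$⟩ˡ i) ⁻¹
    nth-⁻¹ g k 0F = refl
    nth-⁻¹ g k 1F = refl

    nth-ε : ∀ i → nth (ε , ε) i ≈ ε
    nth-ε 0F = refl
    nth-ε 1F = refl

    nth-≡ : ∀ k {i j} → i ≡.≡ j → nth k i ≈ nth k j
    nth-≡ k ≡.refl = refl

    from-cong : ∀ (g h : Permutation′ 2) → g Perm.≈ h →
                ∀ i → g ⟨$⟩ˡ i ≡.≡ h ⟨$⟩ˡ i
    from-cong g h p i = ≡.trans
      (≡.cong (g ⟨$⟩ˡ_) (≡.sym (≡.trans (p (h ⟨$⟩ˡ i)) (Perm.inverseʳ h))))
      (Perm.inverseˡ g)

    assoc-nth : ∀ (g : Permutation′ 2) x l₁ l₂ (h : Permutation′ 2) m i →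
                (x ∙ nth (l₁ , l₂) (g ⟨$⟩ʳ i)) ∙ nth m (h ⟨$⟩ʳ (g ⟨$⟩ʳ i))
                  ≈ x ∙ nth (l₁ ∙ nth m (h ⟨$⟩ʳ 0F) , l₂ ∙ nth m (h ⟨$⟩ʳ 1F))
                            (g ⟨$⟩ʳ i)
    assoc-nth g x l₁ l₂ h m i =
      trans (assoc _ _ _) (∙-congˡ (sym (nth-∙ h l₁ l₂ m (g ⟨$⟩ʳ i))))

    identityʳ-nth : ∀ x i → x ∙ nth (ε , ε) i ≈ x
    identityʳ-nth x i = trans (∙-congˡ (nth-ε i)) (identityʳ x)

    inverseʳ-nth : ∀ (g : Permutation′ 2) k i →
                   nth k i ∙ nth (nth k (g ⟨$⟩ˡ 0F) ⁻¹ , nth k (g ⟨$⟩ˡ 1F) ⁻¹)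
                                 (g ⟨$⟩ʳ i) ≈ ε
    inverseʳ-nth g k i = begin
      nth k i ∙ _                              ≈⟨ ∙-congˡ (nth-⁻¹ g k (g ⟨$⟩ʳ i)) ⟩
      nth k i ∙ nth k (g ⟨$⟩ˡ (g ⟨$⟩ʳ i)) ⁻¹   ≈⟨ ∙-congˡ (⁻¹-cong (nth-≡ k (Perm.inverseˡ g))) ⟩
      nth k i ∙ nth k i ⁻¹                     ≈⟨ inverseʳ _ ⟩
      ε                                        ∎

  S₂≀ : Group a ℓ
  S₂≀ = record
    { Carrier = Triple
    ; _≈_     = _≈ʷ_
    ; _∙_     = _∙ʷ_
    ; ε       = εʷ
    ; _⁻¹     = _⁻¹ʷ
    ; isGroup = record
      { isMonoid = record
        { isSemigroup = record
          { isMagma = record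
            { isEquivalence = record
              { refl  = (λ _ → ≡.refl) , refl , refl
              ; sym   = λ (p , q , r) → (λ i → ≡.sym (p i)) , sym q , sym r
              ; trans = λ (p , q , r) (p′ , q′ , r′) →
                  (λ i → ≡.trans (p i) (p′ i)) , trans q q′ , trans r r′
              }
            ; ∙-cong = λ {(g , _)} {(g′ , _)} {(h , _)} {(h′ , _)} (p , q , r) (p′ , q′ , r′) →
                (λ i → ≡.trans (≡.cong (h ⟨$⟩ʳ_) (p i)) (p′ (g′ ⟨$⟩ʳ i)))
                , ∙-cong q (nth-cong q′ r′ (p 0F))
                , ∙-cong r (nth-cong q′ r′ (p 1F))
            }
          ; assoc = λ (g , k₁ , k₂) (h , l₁ , l₂) (_ , m) →
              (λ _ → ≡.refl)
              , assoc-nth g k₁ l₁ l₂ h m 0F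
              , assoc-nth g k₂ l₁ l₂ h m 1F
          }
        ; identity =
            (λ _ → (λ _ → ≡.refl) , identityˡ _ , identityˡ _)
          , (λ (g , k₁ , k₂) → (λ _ → ≡.refl)
              , identityʳ-nth k₁ (g ⟨$⟩ʳ 0F)
              , identityʳ-nth k₂ (g ⟨$⟩ʳ 1F))
        }
      ; inverse =
          (λ (g , k) → (λ _ → Perm.inverseʳ g) , inverseˡ _ , inverseˡ _)
        , (λ (g , k) → (λ _ → Perm.inverseˡ g)
            , inverseʳ-nth g k 0F , inverseʳ-nth g k 1F)
      ; ⁻¹-cong = λ {(g , _)} {(h , _)} (p , q , r) →
          from-cong g h p
          , ⁻¹-cong (nth-cong q r (from-cong g h p 0F))
          , ⁻¹-cong (nth-cong q r (from-cong g h p 1F))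
      }
    }

  A B C : Pred Triple (a ⊔ ℓ)
  A x = ∃ λ u → ¬ u ≈ ε × x ≈ʷ (Perm.id , u , u)
  B x = ∃ λ u → ¬ u ≈ ε × x ≈ʷ (Perm.id , ε , u)
  C x = ∃ λ u → x ≈ʷ (transpose 0F 1F , u , ε)

  X : Subset (Group.setoid S₂≀) (a ⊔ ℓ)
  X = record
    { members = A ∪ B ∪ C
    ; resp    = λ {x} {y} x≈y →
        let open Group S₂≀ renaming (sym to symʷ; trans to transʷ) using ()
            move = λ z (x≈z : x ≈ʷ z) → transʷ {y} {x} {z} (symʷ {x} {y} x≈y) x≈z
        in λ where
          (inj₁ (u , u≉ε , x≈))        → inj₁ (u , u≉ε , move (Perm.id , u , u) x≈)
          (inj₂ (inj₁ (u , u≉ε , x≈))) → inj₂ (inj₁ (u , u≉ε , move (Perm.id , ε , u) x≈))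
          (inj₂ (inj₂ (u , x≈)))       → inj₂ (inj₂ (u , move (transpose 0F 1F , u , ε) x≈))
    }

{-# OPTIONS --safe #-}

-- In a Cayley digraph the paths x → z → y correspond, via w = z x⁻¹, to the
-- w ∈ X with h w⁻¹ ∈ X, where h = y x⁻¹; undirected edges are the case h = e.
-- Splitting X into the families A, B, C turns each count into three counts of
-- parameters v ∈ K.  With the contributions of A, B, C in this order they are
--   h = (e; e_K, e_K)               (n-1) + (n-1) + 1
--   h = (e; p, p),    p ≠ e_K       (n-2) +   0   + 1
--   h = (e; e_K, q),  q ≠ e_K         0   + (n-2) + 1
--   h = (e; p, q),    p ∉ {e_K, q}    1   +   1   + 1
--   h = (π; p, e_K)                   0   + (n-1) + 0
--   h = (π; p, q),    q ≠ e_K         1   +   0   + 2.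

module Submission where

open import Defs
open import Algebra.Bundles using (Group)
open import Data.Nat.Base using (ℕ; _*_; _∸_; _^_; _>_)
open import Level using (Level)

open import Data.Empty using (⊥-elim)
open import Data.Fin.Base using (punchIn; punchOut)
open import Data.Fin.Patterns using (0F; 1F)
import Data.Fin.Permutation as Perm
open import Data.Fin.Permutation using (Permutation′; _⟨$⟩ʳ_; transpose)
import Data.Fin.Properties as Fin
open import Data.Nat.Base using (suc; _+_; s≤s; z≤n)
import Data.Nat.Properties as ℕ
open import Data.Nat.Tactic.RingSolver using (solve-∀)
open import Data.Product.Base using (∃; _×_; _,_; proj₁; proj₂)
open import Data.Product.Function.NonDependent.Setoid using (_×-inverse_)
open import Data.Product.Relation.Binary.Pointwise.NonDependent as Product using (_×ₛ_)
open import Data.Sum.Base using (_⊎_; inj₁; inj₂)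
open import Data.Sum.Function.Setoid using (_⊎-inverse_)
open import Data.Sum.Relation.Binary.Pointwise as Sum using (inj₁; inj₂; _⊎ₛ_)
open import Data.Unit.Polymorphic.Base using (⊤; tt)
open import Function.Base using (_∘_; id)
open import Function.Bundles using (Inverse; Injection; Bijection)
open import Function.Properties.Bijection using (Bijection⇒Inverse)
import Function.Properties.Inverse as Inv
open import Relation.Binary.Bundles using (Setoid)
open import Relation.Binary.Definitions using (Decidable; _Respects_)
open import Relation.Binary.PropositionalEquality as ≡ using (_≡_)
open import Relation.Nullary using (¬_; yes; no; contradiction)
open import Relation.Nullary.Decidable using (map′)
open import Relation.Unary using (Pred; _∈_; _∪_)
import Algebra.Properties.Group as GroupProperties
import Relation.Binary.Reasoning.Setoid as SetoidReasoning

private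
  variable
    a b ℓ ℓ′ p q : Level
    m n : ℕ

-- Sizes of setoids and of their subsets.

size-≡ : {S : Setoid a ℓ} → m ≡ n → HasSize S m → HasSize S n
size-≡ {S = S} = ≡.subst (HasSize S)

size-bijection : {S : Setoid a ℓ} {T : Setoid b ℓ′} →
                 Bijection T S → HasSize T n → HasSize S n
size-bijection f = Inv.trans (Inv.sym (Bijection⇒Inverse f))

size-× : {S : Setoid a ℓ} {T : Setoid b ℓ′} →
         HasSize S m → HasSize T n → HasSize (S ×ₛ T) (m * n)
size-× hS hT = Inv.trans (hS ×-inverse hT)
  (Inv.trans Product.Pointwise-≡↔≡ (Inv.sym Fin.*↔×))

size-⊎ : {S : Setoid a ℓ} {T : Setoid b ℓ′} →
         HasSize S m → HasSize T n → HasSize (S ⊎ₛ T) (m + n)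
size-⊎ hS hT = Inv.trans (hS ⊎-inverse hT)
  (Inv.trans (Sum.Pointwise-≡↔≡ _ _) (Inv.sym Fin.+↔⊎))

module _ (S : Setoid a ℓ) where
  open Setoid S

  size-⊤ : HasSize S n → HasSize (S ↾ λ _ → ⊤ {p}) n
  size-⊤ = size-bijection record
    { to        = _, tt
    ; cong      = id
    ; bijective = id , λ (x , _) → x , id
    }

  size-⊤⁻¹ : HasSize (S ↾ λ _ → ⊤ {p}) n → HasSize S n
  size-⊤⁻¹ = size-bijection record
    { to        = proj₁
    ; cong      = id
    ; bijective = id , λ x → (x , tt) , id
    }

  size-⇔ : {P : Pred Carrier p} {Q : Pred Carrier q} →
           (∀ x → P x → Q x) → (∀ x → Q x → P x) →
           HasSize (S ↾ P) n → HasSize (S ↾ Q) n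
  size-⇔ P⇒Q Q⇒P = size-bijection record
    { to        = λ (x , px) → x , P⇒Q x px
    ; cong      = id
    ; bijective = id , λ (x , qx) → (x , Q⇒P x qx) , id
    }

  size-empty : {P : Pred Carrier p} → (∀ x → ¬ P x) → HasSize (S ↾ P) 0
  size-empty ¬P = Bijection⇒Inverse record
    { to        = λ (x , px) → ⊥-elim (¬P x px)
    ; cong      = λ { {x , px} → ⊥-elim (¬P x px) }
    ; bijective = (λ { {x , px} → ⊥-elim (¬P x px) }) , λ ()
    }

  size-singleton : {P : Pred Carrier p} (c : Carrier) → P c →
                   (∀ x → P x → x ≈ c) → HasSize (S ↾ P) 1
  size-singleton c pc unique = Bijection⇒Inverse record
    { to        = λ _ → 0F
    ; cong      = λ _ → ≡.refl
    ; bijective =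
        (λ { {x , px} {y , py} _ → trans (unique x px) (sym (unique y py)) })
      , λ { 0F → (c , pc) , λ _ → ≡.refl }
    }

  -- Disjointness is required up to `≈`: distinct representatives of one element must not be counted
  -- on both sides.
  size-∪ : {P : Pred Carrier p} {Q : Pred Carrier q} →
           (∀ {x y} → P x → Q y → ¬ x ≈ y) →
           HasSize (S ↾ P) m → HasSize (S ↾ Q) n → HasSize (S ↾ (P ∪ Q)) (m + n)
  size-∪ {P = P} {Q} disjoint hP hQ = size-bijection record
    { to        = to
    ; cong      = λ { (inj₁ x≈y) → x≈y ; (inj₂ x≈y) → x≈y }
    ; bijective = (λ {x} {y} → injective x y) , surjective
    } (size-⊎ hP hQ)
    where
    T = (S ↾ P) ⊎ₛ (S ↾ Q)

    to : Setoid.Carrier T → ∃ (P ∪ Q)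
    to (inj₁ (x , px)) = x , inj₁ px
    to (inj₂ (x , qx)) = x , inj₂ qx

    injective : ∀ x y → proj₁ (to x) ≈ proj₁ (to y) → Setoid._≈_ T x y
    injective (inj₁ _)        (inj₁ _)        x≈y = inj₁ x≈y
    injective (inj₁ (_ , px)) (inj₂ (_ , qy)) x≈y = contradiction x≈y (disjoint px qy)
    injective (inj₂ (_ , qx)) (inj₁ (_ , py)) x≈y = contradiction (sym x≈y) (disjoint py qx)
    injective (inj₂ _)        (inj₂ _)        x≈y = inj₂ x≈y

    surjective : ∀ y → ∃ λ x → ∀ {z} → Setoid._≈_ T z x → proj₁ (to z) ≈ proj₁ y
    surjective (y , inj₁ py) = inj₁ (y , py) , λ { (inj₁ z≈y) → z≈y }
    surjective (y , inj₂ qy) = inj₂ (y , qy) , λ { (inj₂ z≈y) → z≈y }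

  -- The index of `c` is punched out of `Fin (suc n)`, and the remaining indices close up around the
  -- gap.
  size-remove : {P : Pred Carrier p} {c : Carrier} → P c → HasSize (S ↾ P) (suc n) →
                HasSize (S ↾ λ x → P x × ¬ x ≈ c) n
  size-remove {P = P} {c} pc hP = Bijection⇒Inverse record
    { to        = λ (_ , px , x≉c) → punchOut (to-≢ px x≉c)
    ; cong      = λ { {_ , px , x≉c} {_ , py , y≉c} x≈y →
                      Fin.punchOut-cong c′ {i≢j = to-≢ px x≉c} {i≢k = to-≢ py y≉c} (to-cong x≈y) }
    ; bijective =
        (λ { {_ , px , x≉c} {_ , py , y≉c} eq →
             to-injective (Fin.punchOut-injective (to-≢ px x≉c) (to-≢ py y≉c) eq) })
      -- The preimage of `i` has index `punchIn c′ i` in the larger set; it is not `c`, because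
      -- `punchIn c′` never takes the value `c′`.
      , λ i → let (x , px) = from (punchIn c′ i) in
          (x , px , λ x≈c → Fin.punchInᵢ≢i c′ i
            (≡.trans (≡.sym (strictlyInverseˡ (punchIn c′ i))) (to-cong x≈c)))
          , λ { {_ , pz , z≉c} z≈x → Fin.punchIn-injective c′ _ i
                (≡.trans (Fin.punchIn-punchOut (to-≢ pz z≉c)) (inverseˡ z≈x)) }
    }
    where
    open Inverse hP
    c′ = to (c , pc)

    to-injective : ∀ {x y} → to x ≡ to y → proj₁ x ≈ proj₁ y
    to-injective {x} {y} eq =
      trans (sym (strictlyInverseʳ x)) (trans (from-cong eq) (strictlyInverseʳ y))

    to-≢ : ∀ {x} (px : P x) → ¬ x ≈ c → ¬ c′ ≡ to (x , px)
    to-≢ px x≉c eq = x≉c (sym (to-injective eq))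

  size-≉ : (c : Carrier) → HasSize S (suc n) → HasSize (S ↾ λ x → ¬ x ≈ c) n
  size-≉ c hS = size-⇔ (λ _ → proj₂) (λ _ x≉c → tt , x≉c) (size-remove tt (size-⊤ {p = ℓ} hS))

  -- Elements are equal exactly when their indices are, and indices in `Fin n` can be compared.
  size⇒decidable : HasSize S n → Decidable _≈_
  size⇒decidable hS x y = map′
    (λ eq → trans (sym (strictlyInverseʳ x)) (trans (from-cong eq) (strictlyInverseʳ y)))
    to-cong (to x Fin.≟ to y)
    where open Inverse hS

module _ (S : Setoid a ℓ) (T : Setoid b ℓ′) where
  private
    module S = Setoid S
    module T = Setoid T

  -- The change of variables behind the later counts: `f` will be a map w ↦ w x or w ↦ w⁻¹ x of the
  -- group, a parametrisation of A, B or C by K, or one of a fibre of H by K × K.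
  size-image : {P : Pred S.Carrier p} {Q : Pred T.Carrier q} (f : T.Carrier → S.Carrier) →
               (∀ {u v} → u T.≈ v → f u S.≈ f v) → (∀ {u v} → f u S.≈ f v → u T.≈ v) →
               (∀ u → Q u → P (f u)) → (∀ x → P x → ∃ λ u → Q u × x S.≈ f u) →
               HasSize (T ↾ Q) n → HasSize (S ↾ P) n
  size-image f cong injective Q⇒P P⇒Q = size-bijection record
    { to        = λ (u , qu) → f u , Q⇒P u qu
    ; cong      = cong
    ; bijective = injective , λ (x , px) → let (u , qu , x≈fu) = P⇒Q x px in
        (u , qu) , λ z≈u → S.trans (cong z≈u) (S.sym x≈fu)
    }

-- Paths and degrees in a Cayley digraph.

module CayleyCounting (H : Group a ℓ) (X : Subset (Group.setoid H) p) where
  open Group H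
  open GroupProperties H
  open Subset X renaming (members to Xᵖ)
  open Digraph (Cay H X) using (Arc)
  open SetoidReasoning setoid

  -- Encodes a factorisation h = (h w⁻¹) w into two elements of X by its right factor, which
  -- determines the left one.
  Factors : Carrier → Pred Carrier p
  Factors h w = w ∈ Xᵖ × h ∙ w ⁻¹ ∈ Xᵖ

  Factors-resp : ∀ {h h′} → h ≈ h′ → ∀ w → Factors h w → Factors h′ w
  Factors-resp h≈h′ _ (w∈X , hw∈X) = w∈X , resp (∙-congʳ h≈h′) hw∈X

  size-Factors-≈ : ∀ {h h′} → h ≈ h′ →
                   HasSize (setoid ↾ Factors h) n → HasSize (setoid ↾ Factors h′) n
  size-Factors-≈ h≈h′ = size-⇔ setoid (Factors-resp h≈h′) (Factors-resp (sym h≈h′))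

  size-paths : ∀ x y → HasSize (setoid ↾ Factors (y ∙ x ⁻¹)) n →
               HasSize (setoid ↾ λ z → Arc x z × Arc z y) n
  size-paths x y = size-image setoid setoid (_∙ x) ∙-congʳ (∙-cancelʳ _ _ _)
    (λ w (w∈X , hw∈X) →
        resp (sym (//-rightDividesʳ x w)) w∈X
      , resp (trans (assoc _ _ _) (∙-congˡ (sym (⁻¹-anti-homo-∙ w x)))) hw∈X)
    (λ z (x→z , z→y) → z ∙ x ⁻¹ , (x→z , resp (quotient z) z→y) , sym (//-rightDividesˡ x z))
    where
    quotient : ∀ z → y ∙ z ⁻¹ ≈ (y ∙ x ⁻¹) ∙ (z ∙ x ⁻¹) ⁻¹
    quotient z = begin
      y ∙ z ⁻¹                      ≈⟨ ∙-congˡ (⁻¹-cong (//-rightDividesˡ x z)) ⟨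
      y ∙ ((z ∙ x ⁻¹) ∙ x) ⁻¹       ≈⟨ ∙-congˡ (⁻¹-anti-homo-∙ _ _) ⟩
      y ∙ (x ⁻¹ ∙ (z ∙ x ⁻¹) ⁻¹)    ≈⟨ assoc _ _ _ ⟨
      (y ∙ x ⁻¹) ∙ (z ∙ x ⁻¹) ⁻¹    ∎

  size-undirected : ∀ x → HasSize (setoid ↾ Factors ε) n →
                    HasSize (setoid ↾ λ y → Arc x y × Arc y x) n
  size-undirected x = size-paths x x ∘ size-Factors-≈ (sym (inverseʳ x))

  size-out : ∀ x → HasSize (setoid ↾ Xᵖ) n → HasSize (setoid ↾ λ y → Arc x y) n
  size-out x = size-image setoid setoid (_∙ x) ∙-congʳ (∙-cancelʳ _ _ _)
    (λ w → resp (sym (//-rightDividesʳ x w)))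
    (λ y x→y → y ∙ x ⁻¹ , x→y , sym (//-rightDividesˡ x y))

  -- An arc y → x means x y⁻¹ = w ∈ X, that is y = w⁻¹ x. Inverting the parameter gives |X| again,
  -- although X need not be closed under inversion.
  size-in : ∀ x → HasSize (setoid ↾ Xᵖ) n → HasSize (setoid ↾ λ y → Arc y x) n
  size-in x = size-image setoid setoid (λ w → w ⁻¹ ∙ x)
    (∙-congʳ ∘ ⁻¹-cong) (⁻¹-injective ∘ ∙-cancelʳ _ _ _)
    (λ w → resp (sym (begin
      x ∙ (w ⁻¹ ∙ x) ⁻¹      ≈⟨ ∙-congˡ (⁻¹-anti-homo-∙ _ _) ⟩
      x ∙ (x ⁻¹ ∙ w ⁻¹ ⁻¹)   ≈⟨ assoc _ _ _ ⟨
      (x ∙ x ⁻¹) ∙ w ⁻¹ ⁻¹   ≈⟨ ∙-cong (inverseʳ x) (⁻¹-involutive w) ⟩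
      ε ∙ w                  ≈⟨ identityˡ w ⟩
      w                      ∎)))
    (λ y y→x → x ∙ y ⁻¹ , y→x , sym (begin
      (x ∙ y ⁻¹) ⁻¹ ∙ x      ≈⟨ ∙-congʳ (⁻¹-anti-homo-∙ _ _) ⟩
      (y ⁻¹ ⁻¹ ∙ x ⁻¹) ∙ x   ≈⟨ //-rightDividesˡ x _ ⟩
      y ⁻¹ ⁻¹                ≈⟨ ⁻¹-involutive y ⟩
      y                      ∎))

  loopless : ¬ ε ∈ Xᵖ → ∀ x → ¬ Arc x x
  loopless ε∉X x x→x = ε∉X (resp (inverseʳ x) x→x)

-- The two permutations of two points.

π : Permutation′ 2
π = transpose 0F 1F

id≉π : ¬ Perm.id Perm.≈ π
id≉π id≈π = contradiction (id≈π 0F) λ ()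

-- Of the four maps on two points, injectivity rules out the two constant ones.
S₂-cases : (g : Permutation′ 2) → g Perm.≈ Perm.id ⊎ g Perm.≈ π
-- The images enter as variables tied to `g` by equations, so that they can be matched on.
S₂-cases g = cases (g ⟨$⟩ʳ 0F) (g ⟨$⟩ʳ 1F) ≡.refl ≡.refl
  where
  not-constant : ¬ g ⟨$⟩ʳ 0F ≡ g ⟨$⟩ʳ 1F
  not-constant eq = contradiction (Injection.injective (Inv.Inverse⇒Injection g) eq) λ ()

  cases : ∀ i j → g ⟨$⟩ʳ 0F ≡ i → g ⟨$⟩ʳ 1F ≡ j → g Perm.≈ Perm.id ⊎ g Perm.≈ π
  cases 0F 0F p q = contradiction (≡.trans p (≡.sym q)) not-constant
  cases 0F 1F p q = inj₁ λ { 0F → p ; 1F → q }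
  cases 1F 0F p q = inj₂ λ { 0F → p ; 1F → q }
  cases 1F 1F p q = contradiction (≡.trans p (≡.sym q)) not-constant

-- The right-hand side is what `2 * n ^ 2` unfolds to.
n²+n²≡2n² : ∀ n → n * n + n * n ≡ 2 * (n * (n * 1))
n²+n²≡2n² = solve-∀

-- For n = m + 2 the summands are |A|, |B| and |C|. Proving the equation with 2 added to the sum
-- lets `_∸ 2` compute away.
valency : ∀ m → suc m + (suc m + suc (suc m)) ≡ 3 * suc (suc m) ∸ 2
valency m = ≡.cong (_∸ 2) (lemma m)
  where
  lemma : ∀ m → 2 + (suc m + (suc m + suc (suc m))) ≡ 3 * suc (suc m)
  lemma = solve-∀

edges : ∀ m → suc m + (suc m + 1) ≡ 2 * suc (suc m) ∸ 1
edges m = ≡.cong (_∸ 1) (lemma m)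
  where
  lemma : ∀ m → 1 + (suc m + (suc m + 1)) ≡ 2 * suc (suc m)
  lemma = solve-∀

-- Membership in X and counting over its three families.

module WreathCounting (K : Group a ℓ) where
  open Group K
  open GroupProperties K
  open Wreath K
  open CayleyCounting S₂≀ X using (Factors)

  private
    module W = Group S₂≀

  Xᵖ : Pred Triple _
  Xᵖ = Subset.members X

  -- The trivial permutation excludes C. In A and B the parameter u is itself a component, so the
  -- existential turns into equations and inequations between components.
  even-∈X⁻ : ((g , k₁ , k₂) : Triple) → g Perm.≈ Perm.id → (g , k₁ , k₂) ∈ Xᵖ →
             (k₁ ≈ k₂ × ¬ k₁ ≈ ε) ⊎ (k₁ ≈ ε × ¬ k₂ ≈ ε)
  even-∈X⁻ _ g≈id (inj₁ (u , u≉ε , _ , k₁≈u , k₂≈u)) =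
    inj₁ (trans k₁≈u (sym k₂≈u) , λ k₁≈ε → u≉ε (trans (sym k₁≈u) k₁≈ε))
  even-∈X⁻ _ g≈id (inj₂ (inj₁ (u , u≉ε , _ , k₁≈ε , k₂≈u))) =
    inj₂ (k₁≈ε , λ k₂≈ε → u≉ε (trans (sym k₂≈u) k₂≈ε))
  even-∈X⁻ _ g≈id (inj₂ (inj₂ (u , g≈π , _))) =
    contradiction (λ i → ≡.trans (≡.sym (g≈id i)) (g≈π i)) id≉π

  even-∈X⁺ : ((g , k₁ , k₂) : Triple) → g Perm.≈ Perm.id →
             (k₁ ≈ k₂ × ¬ k₁ ≈ ε) ⊎ (k₁ ≈ ε × ¬ k₂ ≈ ε) → (g , k₁ , k₂) ∈ Xᵖ
  even-∈X⁺ _ g≈id (inj₁ (k₁≈k₂ , k₁≉ε)) = inj₁ (_ , k₁≉ε , g≈id , refl , sym k₁≈k₂)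
  even-∈X⁺ _ g≈id (inj₂ (k₁≈ε , k₂≉ε))  = inj₂ (inj₁ (_ , k₂≉ε , g≈id , k₁≈ε , refl))

  -- Only C contains swaps, and its parameter leaves the first component free.
  odd-∈X⁻ : ((g , k₁ , k₂) : Triple) → g Perm.≈ π → (g , k₁ , k₂) ∈ Xᵖ → k₂ ≈ ε
  odd-∈X⁻ _ g≈π (inj₁ (_ , _ , g≈id , _)) =
    contradiction (λ i → ≡.trans (≡.sym (g≈id i)) (g≈π i)) id≉π
  odd-∈X⁻ _ g≈π (inj₂ (inj₁ (_ , _ , g≈id , _))) =
    contradiction (λ i → ≡.trans (≡.sym (g≈id i)) (g≈π i)) id≉π
  odd-∈X⁻ _ g≈π (inj₂ (inj₂ (_ , _ , _ , k₂≈ε))) = k₂≈ε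

  odd-∈X⁺ : ((g , k₁ , k₂) : Triple) → g Perm.≈ π → k₂ ≈ ε → (g , k₁ , k₂) ∈ Xᵖ
  odd-∈X⁺ _ g≈π k₂≈ε = inj₂ (inj₂ (_ , g≈π , refl , k₂≈ε))

  ε∉X : ¬ εʷ ∈ Xᵖ
  ε∉X ε∈X with even-∈X⁻ εʷ (λ _ → ≡.refl) ε∈X
  ... | inj₁ (_ , ε≉ε) = ε≉ε refl
  ... | inj₂ (_ , ε≉ε) = ε≉ε refl

  -- Each family is parametrised injectively by v, with v = e_K allowed only in C. The families are
  -- disjoint: C by its permutation, A and B by their first component.
  size-X∩ : ∀ {i j k} {Q : Pred Triple q} → Q Respects _≈ʷ_ →
    HasSize (setoid ↾ λ v → ¬ v ≈ ε × Q (Perm.id , v , v)) i →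
    HasSize (setoid ↾ λ v → ¬ v ≈ ε × Q (Perm.id , ε , v)) j →
    HasSize (setoid ↾ λ v → Q (π , v , ε)) k →
    HasSize (W.setoid ↾ λ w → w ∈ Xᵖ × Q w) (i + (j + k))
  size-X∩ {Q = Q} Q-resp hA hB hC = size-⇔ W.setoid
    (λ { _ (inj₁ (w∈A , qw))        → inj₁ w∈A , qw
       ; _ (inj₂ (inj₁ (w∈B , qw))) → inj₂ (inj₁ w∈B) , qw
       ; _ (inj₂ (inj₂ (w∈C , qw))) → inj₂ (inj₂ w∈C) , qw })
    (λ { _ (inj₁ w∈A , qw)        → inj₁ (w∈A , qw)
       ; _ (inj₂ (inj₁ w∈B) , qw) → inj₂ (inj₁ (w∈B , qw))
       ; _ (inj₂ (inj₂ w∈C) , qw) → inj₂ (inj₂ (w∈C , qw)) })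
    (size-∪ W.setoid A-disjoint size-A (size-∪ W.setoid B-disjoint size-B size-C))
    where
    size-A = size-image W.setoid setoid {P = λ w → w ∈ A × Q w} (λ v → Perm.id , v , v)
      (λ u≈v → (λ _ → ≡.refl) , u≈v , u≈v) (λ (_ , u≈v , _) → u≈v)
      (λ v (v≉ε , qv) → (v , v≉ε , W.refl {Perm.id , v , v}) , qv)
      -- `Q-resp` carries `Q` from `w` to its normal form (e; v, v), where the parameter count is
      -- stated.
      (λ w ((v , v≉ε , w≈) , qw) → v , (v≉ε , Q-resp w≈ qw) , w≈) hA
    size-B = size-image W.setoid setoid {P = λ w → w ∈ B × Q w} (λ v → Perm.id , ε , v)
      (λ u≈v → (λ _ → ≡.refl) , refl , u≈v) (λ (_ , _ , u≈v) → u≈v)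
      (λ v (v≉ε , qv) → (v , v≉ε , W.refl {Perm.id , ε , v}) , qv)
      (λ w ((v , v≉ε , w≈) , qw) → v , (v≉ε , Q-resp w≈ qw) , w≈) hB
    size-C = size-image W.setoid setoid {P = λ w → w ∈ C × Q w} (λ v → π , v , ε)
      (λ u≈v → (λ _ → ≡.refl) , u≈v , refl) (λ (_ , u≈v , _) → u≈v)
      (λ v qv → (v , W.refl {π , v , ε}) , qv)
      (λ w ((v , w≈) , qw) → v , Q-resp w≈ qw , w≈) hC

    A-disjoint : ∀ {x y} → x ∈ A × Q x → (y ∈ B × Q y) ⊎ (y ∈ C × Q y) → ¬ x ≈ʷ y
    A-disjoint ((u , u≉ε , _ , x₁≈u , _) , _) (inj₁ ((_ , _ , _ , y₁≈ε , _) , _)) (_ , x₁≈y₁ , _) =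
      u≉ε (trans (sym x₁≈u) (trans x₁≈y₁ y₁≈ε))
    A-disjoint ((_ , _ , g≈id , _) , _) (inj₂ ((_ , h≈π , _) , _)) (g≈h , _) =
      id≉π λ i → ≡.trans (≡.sym (g≈id i)) (≡.trans (g≈h i) (h≈π i))

    B-disjoint : ∀ {x y} → x ∈ B × Q x → y ∈ C × Q y → ¬ x ≈ʷ y
    B-disjoint ((_ , _ , g≈id , _) , _) ((_ , h≈π , _) , _) (g≈h , _) =
      id≉π λ i → ≡.trans (≡.sym (g≈id i)) (≡.trans (g≈h i) (h≈π i))

  -- Reduction of factorisations to equations in K.

  private
    quotient-resp : ∀ h {w w′} → w ≈ʷ w′ → (h ∙ʷ (w ⁻¹ʷ)) ∈ Xᵖ → (h ∙ʷ (w′ ⁻¹ʷ)) ∈ Xᵖ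
    quotient-resp h {w} {w′} w≈w′ = Subset.resp X {h ∙ʷ (w ⁻¹ʷ)} {h ∙ʷ (w′ ⁻¹ʷ)}
      (W.∙-congˡ {h} {w ⁻¹ʷ} {w′ ⁻¹ʷ} (W.⁻¹-cong {w} {w′} w≈w′))

    x∙ε⁻¹≈x : ∀ x → x ∙ ε ⁻¹ ≈ x
    x∙ε⁻¹≈x x = trans (∙-congˡ ε⁻¹≈ε) (identityʳ x)

    x≈y∙v⁻¹⇒x∙v≈y : ∀ {x y v} → x ≈ y ∙ v ⁻¹ → x ∙ v ≈ y
    x≈y∙v⁻¹⇒x∙v≈y {v = v} x≈ = trans (∙-congʳ x≈) (//-rightDividesˡ v _)

    x∙v≈y⇒x≈y∙v⁻¹ : ∀ {x y v} → x ∙ v ≈ y → x ≈ y ∙ v ⁻¹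
    x∙v≈y⇒x≈y∙v⁻¹ = x≈z//y _ _ _

  -- Here and in size-Factors-odd, the three conditions on v say h w⁻¹ ∈ X for
  -- w = (e; v, v), (e; e_K, v) and (π; v, e_K), with the division by v cleared.
  size-Factors-even : ∀ {i j k} p q →
    HasSize (setoid ↾ λ v → ¬ v ≈ ε × ((p ≈ q × ¬ p ≈ v) ⊎ (p ≈ v × ¬ q ≈ v))) i →
    HasSize (setoid ↾ λ v → ¬ v ≈ ε × ((p ∙ v ≈ q × ¬ p ≈ ε) ⊎ (p ≈ ε × ¬ q ≈ v))) j →
    HasSize (setoid ↾ λ v → q ≈ v) k →
    HasSize (W.setoid ↾ Factors (Perm.id , p , q)) (i + (j + k))
  size-Factors-even p q hA hB hC = size-X∩
    (λ {w} {w′} → quotient-resp (Perm.id , p , q) {w} {w′})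
    (size-⇔ setoid
      (λ { v (v≉ε , inj₁ (p≈q , p≉v)) → v≉ε , even-∈X⁺ (h/A v) (λ _ → ≡.refl)
             (inj₁ (∙-congʳ p≈q , p≉v ∘ x∙y⁻¹≈ε⇒x≈y p v))
         ; v (v≉ε , inj₂ (p≈v , q≉v)) → v≉ε , even-∈X⁺ (h/A v) (λ _ → ≡.refl)
             (inj₂ (x≈y⇒x∙y⁻¹≈ε p≈v , q≉v ∘ x∙y⁻¹≈ε⇒x≈y q v)) })
      (λ v (v≉ε , ∈X) → v≉ε , fromA v (even-∈X⁻ (h/A v) (λ _ → ≡.refl) ∈X)) hA)
    (size-⇔ setoid
      (λ { v (v≉ε , inj₁ (pv≈q , p≉ε)) → v≉ε , even-∈X⁺ (h/B v) (λ _ → ≡.refl)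
             (inj₁ (trans (x∙ε⁻¹≈x p) (x∙v≈y⇒x≈y∙v⁻¹ pv≈q) , p≉ε ∘ trans (sym (x∙ε⁻¹≈x p))))
         ; v (v≉ε , inj₂ (p≈ε , q≉v)) → v≉ε , even-∈X⁺ (h/B v) (λ _ → ≡.refl)
             (inj₂ (trans (x∙ε⁻¹≈x p) p≈ε , q≉v ∘ x∙y⁻¹≈ε⇒x≈y q v)) })
      (λ v (v≉ε , ∈X) → v≉ε , fromB v (even-∈X⁻ (h/B v) (λ _ → ≡.refl) ∈X)) hB)
    (size-⇔ setoid
      -- The inverse of (π; v, e_K) is (π; e_K, v⁻¹), so v lands beside q and h w⁻¹ ∈ C reads q v⁻¹
      -- = e_K.
      (λ v q≈v → odd-∈X⁺ (h/C v) (λ { 0F → ≡.refl ; 1F → ≡.refl }) (x≈y⇒x∙y⁻¹≈ε q≈v))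
      (λ v ∈X → x∙y⁻¹≈ε⇒x≈y q v (odd-∈X⁻ (h/C v) (λ { 0F → ≡.refl ; 1F → ≡.refl }) ∈X)) hC)
    where
    quotient : Triple → Triple
    quotient w = (Perm.id , p , q) ∙ʷ (w ⁻¹ʷ)

    h/A h/B h/C : Carrier → Triple
    h/A v = quotient (Perm.id , v , v)
    h/B v = quotient (Perm.id , ε , v)
    h/C v = quotient (π , v , ε)

    fromA : ∀ v →
      (p ∙ v ⁻¹ ≈ q ∙ v ⁻¹ × ¬ p ∙ v ⁻¹ ≈ ε) ⊎ (p ∙ v ⁻¹ ≈ ε × ¬ q ∙ v ⁻¹ ≈ ε) →
      (p ≈ q × ¬ p ≈ v) ⊎ (p ≈ v × ¬ q ≈ v)
    fromA v (inj₁ (eq , ≉ε)) = inj₁ (∙-cancelʳ _ _ _ eq , ≉ε ∘ x≈y⇒x∙y⁻¹≈ε)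
    fromA v (inj₂ (≈ε , ≉ε)) = inj₂ (x∙y⁻¹≈ε⇒x≈y p v ≈ε , ≉ε ∘ x≈y⇒x∙y⁻¹≈ε)

    fromB : ∀ v →
      (p ∙ ε ⁻¹ ≈ q ∙ v ⁻¹ × ¬ p ∙ ε ⁻¹ ≈ ε) ⊎ (p ∙ ε ⁻¹ ≈ ε × ¬ q ∙ v ⁻¹ ≈ ε) →
      (p ∙ v ≈ q × ¬ p ≈ ε) ⊎ (p ≈ ε × ¬ q ≈ v)
    fromB v (inj₁ (eq , ≉ε)) =
      inj₁ (x≈y∙v⁻¹⇒x∙v≈y (trans (sym (x∙ε⁻¹≈x p)) eq) , ≉ε ∘ trans (x∙ε⁻¹≈x p))
    fromB v (inj₂ (≈ε , ≉ε)) =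
      inj₂ (trans (sym (x∙ε⁻¹≈x p)) ≈ε , ≉ε ∘ x≈y⇒x∙y⁻¹≈ε)

  size-Factors-odd : ∀ {i j k} p q →
    HasSize (setoid ↾ λ v → ¬ v ≈ ε × q ≈ v) i →
    HasSize (setoid ↾ λ v → ¬ v ≈ ε × q ≈ ε) j →
    HasSize (setoid ↾ λ v → (p ≈ q ∙ v × ¬ p ≈ v) ⊎ (p ≈ v × ¬ q ≈ ε)) k →
    HasSize (W.setoid ↾ Factors (π , p , q)) (i + (j + k))
  size-Factors-odd p q hA hB hC = size-X∩
    (λ {w} {w′} → quotient-resp (π , p , q) {w} {w′})
    (size-⇔ setoid
      (λ v (v≉ε , q≈v) → v≉ε , odd-∈X⁺ (h/A v) (λ _ → ≡.refl) (x≈y⇒x∙y⁻¹≈ε q≈v))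
      (λ v (v≉ε , ∈X) → v≉ε , x∙y⁻¹≈ε⇒x≈y q v (odd-∈X⁻ (h/A v) (λ _ → ≡.refl) ∈X)) hA)
    (size-⇔ setoid
      -- The swap in h moves v⁻¹ beside p, which C leaves free; the second component is just q.
      (λ v (v≉ε , q≈ε) → v≉ε , odd-∈X⁺ (h/B v) (λ _ → ≡.refl) (trans (x∙ε⁻¹≈x q) q≈ε))
      (λ v (v≉ε , ∈X) → v≉ε , trans (sym (x∙ε⁻¹≈x q)) (odd-∈X⁻ (h/B v) (λ _ → ≡.refl) ∈X)) hB)
    (size-⇔ setoid
      -- The two swaps cancel, so the quotient is (e; p v⁻¹, q), to be tested against A and B.
      (λ { v (inj₁ (p≈qv , p≉v)) → even-∈X⁺ (h/C v) π∘π⁻¹≈id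
             (inj₁ ( trans (sym (x∙v≈y⇒x≈y∙v⁻¹ (sym p≈qv))) (sym (x∙ε⁻¹≈x q))
                   , p≉v ∘ x∙y⁻¹≈ε⇒x≈y p v))
         ; v (inj₂ (p≈v , q≉ε)) → even-∈X⁺ (h/C v) π∘π⁻¹≈id
             (inj₂ (x≈y⇒x∙y⁻¹≈ε p≈v , q≉ε ∘ trans (sym (x∙ε⁻¹≈x q)))) })
      (λ v ∈X → fromC v (even-∈X⁻ (h/C v) π∘π⁻¹≈id ∈X)) hC)
    where
    quotient : Triple → Triple
    quotient w = (π , p , q) ∙ʷ (w ⁻¹ʷ)

    h/A h/B h/C : Carrier → Triple
    h/A v = quotient (Perm.id , v , v)
    h/B v = quotient (Perm.id , ε , v)
    h/C v = quotient (π , v , ε)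

    π∘π⁻¹≈id : (π Perm.∘ₚ Perm.flip π) Perm.≈ Perm.id
    π∘π⁻¹≈id _ = Perm.inverseˡ π

    fromC : ∀ v →
      (p ∙ v ⁻¹ ≈ q ∙ ε ⁻¹ × ¬ p ∙ v ⁻¹ ≈ ε) ⊎ (p ∙ v ⁻¹ ≈ ε × ¬ q ∙ ε ⁻¹ ≈ ε) →
      (p ≈ q ∙ v × ¬ p ≈ v) ⊎ (p ≈ v × ¬ q ≈ ε)
    fromC v (inj₁ (eq , ≉ε)) =
      inj₁ (sym (x≈y∙v⁻¹⇒x∙v≈y (trans (sym (x∙ε⁻¹≈x q)) (sym eq))) , ≉ε ∘ x≈y⇒x∙y⁻¹≈ε)
    fromC v (inj₂ (≈ε , ≉ε)) =
      inj₂ (x∙y⁻¹≈ε⇒x≈y p v ≈ε , ≉ε ∘ trans (x∙ε⁻¹≈x q))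

  -- H splits into the fibres over e and π of the permutation component, each a copy of K × K.
  size-S₂≀ : HasSize setoid n → HasSize W.setoid (2 * n ^ 2)
  size-S₂≀ {n} hK = size-⊤⁻¹ W.setoid {p = ℓ} (size-≡ (n²+n²≡2n² n)
    (size-⇔ W.setoid (λ _ _ → tt) (λ (g , _) _ → S₂-cases g)
      (size-∪ W.setoid
        (λ g≈id h≈π (g≈h , _) →
          id≉π λ i → ≡.trans (≡.sym (g≈id i)) (≡.trans (g≈h i) (h≈π i)))
        (size-fibre Perm.id) (size-fibre π))))
    where
    size-fibre : ∀ g → HasSize (W.setoid ↾ λ (h , _) → h Perm.≈ g) (n * n)
    size-fibre g = size-image W.setoid (setoid ×ₛ setoid) (g ,_)
      (λ eq → (λ _ → ≡.refl) , eq) proj₂ (λ _ _ _ → ≡.refl)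
      (λ (_ , k) h≈g → k , tt , h≈g , refl , refl)
      (size-⊤ (setoid ×ₛ setoid) {p = ℓ} (size-× hK hK))

  -- The size of X, and factorisations of the identity and of elements of X.

  module _ (hK : HasSize setoid (suc (suc m))) where

    size-≉ε : HasSize (setoid ↾ λ v → ¬ v ≈ ε) (suc m)
    size-≉ε = size-≉ setoid ε hK

    size-≉ε-≉ : ∀ {c} → ¬ c ≈ ε → HasSize (setoid ↾ λ v → ¬ v ≈ ε × ¬ c ≈ v) m
    size-≉ε-≉ c≉ε = size-⇔ setoid
      (λ v (v≉ε , v≉c) → v≉ε , v≉c ∘ sym) (λ v (v≉ε , c≉v) → v≉ε , c≉v ∘ sym)
      (size-remove setoid c≉ε size-≉ε)

    size-≈ : ∀ c → HasSize (setoid ↾ λ v → c ≈ v) 1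
    size-≈ c = size-singleton setoid c refl (λ _ → sym)

    size-X : HasSize (W.setoid ↾ Xᵖ) (suc m + (suc m + suc (suc m)))
    size-X = size-⇔ W.setoid (λ _ → proj₁) (λ _ w∈X → w∈X , tt)
      (size-X∩ {q = ℓ} (λ _ _ → tt)
        (size-⇔ setoid (λ _ v≉ε → v≉ε , tt) (λ _ → proj₁) size-≉ε)
        (size-⇔ setoid (λ _ v≉ε → v≉ε , tt) (λ _ → proj₁) size-≉ε)
        (size-⊤ setoid hK))

    -- A and B are closed under inversion, while (π; v, e_K)⁻¹ = (π; e_K, v⁻¹) lies in C only for v
    -- = e_K.
    size-Factors-ε : HasSize (W.setoid ↾ Factors εʷ) (suc m + (suc m + 1))
    size-Factors-ε = size-Factors-even ε ε
      (size-⇔ setoid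
        (λ v v≉ε → v≉ε , inj₁ (refl , v≉ε ∘ sym)) (λ _ → proj₁) size-≉ε)
      (size-⇔ setoid
        (λ v v≉ε → v≉ε , inj₂ (refl , v≉ε ∘ sym)) (λ _ → proj₁) size-≉ε)
      (size-≈ ε)

    -- For w in A, the quotient stays in A unless v = u. For w in B it is (e; u, u v⁻¹), which would
    -- need v = e_K or u = e_K. For w in C, v = u.
    size-Factors-A : ∀ {u} → ¬ u ≈ ε →
                     HasSize (W.setoid ↾ Factors (Perm.id , u , u)) (m + (0 + 1))
    size-Factors-A {u} u≉ε = size-Factors-even u u
      (size-⇔ setoid
        (λ { v (v≉ε , u≉v) → v≉ε , inj₁ (refl , u≉v) })
        (λ { v (v≉ε , inj₁ (_ , u≉v)) → v≉ε , u≉v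
           ; v (v≉ε , inj₂ (u≈v , u≉v)) → contradiction u≈v u≉v })
        (size-≉ε-≉ u≉ε))
      (size-empty setoid λ
        { v (v≉ε , inj₁ (uv≈u , _)) → v≉ε (identityʳ-unique u v uv≈u)
        ; v (_ , inj₂ (u≈ε , _))    → u≉ε u≈ε })
      (size-≈ u)

    -- For w in A, the quotient (e; v⁻¹, u v⁻¹) would need u = e_K or v = e_K. For w in B it stays
    -- in B unless v = u. For w in C, v = u.
    size-Factors-B : ∀ {u} → ¬ u ≈ ε →
                     HasSize (W.setoid ↾ Factors (Perm.id , ε , u)) (0 + (m + 1))
    size-Factors-B {u} u≉ε = size-Factors-even ε u
      (size-empty setoid λ
        { v (_ , inj₁ (ε≈u , _))   → u≉ε (sym ε≈u)
        ; v (v≉ε , inj₂ (ε≈v , _)) → v≉ε (sym ε≈v) })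
      (size-⇔ setoid
        (λ { v (v≉ε , u≉v) → v≉ε , inj₂ (refl , u≉v) })
        (λ { v (v≉ε , inj₁ (_ , ε≉ε)) → contradiction refl ε≉ε
           ; v (v≉ε , inj₂ (_ , u≉v)) → v≉ε , u≉v })
        (size-≉ε-≉ u≉ε))
      (size-≈ u)

    -- Dividing by any element of B stays in C. Division by A would need v = e_K, and division by C
    -- leaves (e; u v⁻¹, e_K), which is in neither A nor B.
    size-Factors-C : ∀ u → HasSize (W.setoid ↾ Factors (π , u , ε)) (0 + (suc m + 0))
    size-Factors-C u = size-Factors-odd u ε
      (size-empty setoid λ v (v≉ε , ε≈v) → v≉ε (sym ε≈v))
      (size-⇔ setoid (λ v v≉ε → v≉ε , refl) (λ _ → proj₁) size-≉ε)
      (size-empty setoid λ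
        { v (inj₁ (u≈εv , u≉v)) → u≉v (trans u≈εv (identityˡ v))
        ; v (inj₂ (_ , ε≉ε))    → ε≉ε refl })

  -- One factorisation of each type B·A, A·B and C·C, with right factors (e; k₁, k₁), (e; e_K, k₁⁻¹
  -- k₂) and (π; k₂, e_K).
  size-Factors-even-∉X : ∀ {k₁ k₂} → ¬ k₁ ≈ ε → ¬ k₁ ≈ k₂ →
                         HasSize (W.setoid ↾ Factors (Perm.id , k₁ , k₂)) 3
  size-Factors-even-∉X {k₁} {k₂} k₁≉ε k₁≉k₂ = size-Factors-even k₁ k₂
    (size-singleton setoid k₁ (k₁≉ε , inj₂ (refl , k₁≉k₂ ∘ sym)) λ
      { v (_ , inj₁ (k₁≈k₂ , _)) → contradiction k₁≈k₂ k₁≉k₂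
      ; v (_ , inj₂ (k₁≈v , _))  → sym k₁≈v })
    (size-singleton setoid (k₁ ⁻¹ ∙ k₂)
      ( (λ eq → k₁≉k₂ (trans (sym (identityʳ k₁))
          (trans (∙-congˡ (sym eq)) (\\-leftDividesˡ k₁ k₂))))
      , inj₁ (\\-leftDividesˡ k₁ k₂ , k₁≉ε)) λ
      { v (_ , inj₁ (k₁v≈k₂ , _)) → y≈x\\z k₁ v k₂ k₁v≈k₂
      ; v (_ , inj₂ (k₁≈ε , _))   → contradiction k₁≈ε k₁≉ε })
    (size-singleton setoid k₂ refl (λ _ → sym))

  -- One factorisation of each type C·A, A·C and B·C, with right factors (e; k₂, k₂), (π; k₂⁻¹ k₁,
  -- e_K) and (π; k₁, e_K).
  size-Factors-odd-∉X : ∀ {k₁ k₂} → ¬ k₂ ≈ ε →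
                        HasSize (W.setoid ↾ Factors (π , k₁ , k₂)) 3
  size-Factors-odd-∉X {k₁} {k₂} k₂≉ε = size-Factors-odd k₁ k₂
    (size-singleton setoid k₂ (k₂≉ε , refl) (λ _ → sym ∘ proj₂))
    (size-empty setoid λ v (_ , k₂≈ε) → k₂≉ε k₂≈ε)
    (size-∪ setoid {P = λ v → k₁ ≈ k₂ ∙ v × ¬ k₁ ≈ v} {Q = λ v → k₁ ≈ v × ¬ k₂ ≈ ε}
      (λ { (_ , k₁≉x) (k₁≈y , _) x≈y → k₁≉x (trans k₁≈y (sym x≈y)) })
      (size-singleton setoid (k₂ ⁻¹ ∙ k₁)
        ( sym (\\-leftDividesˡ k₂ k₁)
        -- If the two solutions in C coincided, k₁ = k₂⁻¹ k₁ would force k₂ = e_K.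
        , λ eq → k₂≉ε (identityˡ-unique k₂ k₁
            (trans (∙-congˡ eq) (\\-leftDividesˡ k₂ k₁))))
        (λ v (k₁≈k₂v , _) → y≈x\\z k₂ v k₁ (sym k₁≈k₂v)))
      (size-singleton setoid k₁ (refl , k₂≉ε) (λ _ → sym ∘ proj₁)))

-- Assembly of the parameters.

theorem3p2 : ∀ {c ℓ : Level} (n : ℕ) → n > 1 →
    (K : Group c ℓ) → HasSize (Group.setoid K) n →
    let open Wreath K in
    IsDSRG (Cay S₂≀ X) (2 * n ^ 2) (3 * n ∸ 2) (2 * n ∸ 1) (n ∸ 1) 3
-- Writing n as m + 2 turns n - 1 and n - 2 into `suc m` and `m`.
theorem3p2 (suc (suc m)) (s≤s (s≤s z≤n)) K hK = record
  { order      = size-S₂≀ hK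
  ; loopless   = loopless ε∉X
  ; out-degree = λ x → size-out x (size-≡ (valency m) (size-X hK))
  ; in-degree  = λ x → size-in x (size-≡ (valency m) (size-X hK))
  ; undirected = λ x → size-undirected x (size-≡ (edges m) (size-Factors-ε hK))
  ; paths-arc  = λ x y _ x→y → size-paths x y (size-Factors-∈X (y W.∙ x W.⁻¹) x→y)
  ; paths-¬arc = λ x y x≉y x↛y → size-paths x y
      (size-Factors-∉X (y W.∙ x W.⁻¹) (λ eq → x≉y (W.sym {y} {x} (x∙y⁻¹≈ε⇒x≈y y x eq))) x↛y)
  }
  where
  open Group K
  open Wreath K
  open WreathCounting K
  open CayleyCounting S₂≀ X
  open GroupProperties S₂≀ using (x∙y⁻¹≈ε⇒x≈y)
  module W = Group S₂≀

  -- The three families agree on λ: A and B give (n - 2) + 1, and C gives n - 1 at once.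
  size-Factors-∈X : ∀ h → h ∈ Xᵖ → HasSize (W.setoid ↾ Factors h) (suc m)
  size-Factors-∈X h (inj₁ (u , u≉ε , h≈)) =
    size-Factors-≈ {h = Perm.id , u , u} {h} (W.sym {h} {Perm.id , u , u} h≈)
      (size-≡ (ℕ.+-comm m 1) (size-Factors-A hK u≉ε))
  size-Factors-∈X h (inj₂ (inj₁ (u , u≉ε , h≈))) =
    size-Factors-≈ {h = Perm.id , ε , u} {h} (W.sym {h} {Perm.id , ε , u} h≈)
      (size-≡ (ℕ.+-comm m 1) (size-Factors-B hK u≉ε))
  size-Factors-∈X h (inj₂ (inj₂ (u , h≈))) =
    size-Factors-≈ {h = π , u , ε} {h} (W.sym {h} {π , u , ε} h≈)
      (size-≡ (ℕ.+-identityʳ (suc m)) (size-Factors-C hK u))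

  _≟_ : Decidable _≈_
  _≟_ = size⇒decidable setoid hK

  -- Failure of membership supplies the inequations of the two generic counts: k₂ ≠ e_K for a swap,
  -- and k₁ ≠ e_K, k₁ ≠ k₂ otherwise.
  size-Factors-∉X : ∀ h → ¬ h ≈ʷ εʷ → ¬ h ∈ Xᵖ → HasSize (W.setoid ↾ Factors h) 3
  size-Factors-∉X h@(g , k₁ , k₂) h≉ε h∉X with S₂-cases g
  ... | inj₂ g≈π =
    size-Factors-≈ {h = π , k₁ , k₂} {h} ((λ i → ≡.sym (g≈π i)) , refl , refl)
      (size-Factors-odd-∉X (h∉X ∘ odd-∈X⁺ h g≈π))
  ... | inj₁ g≈id =
    size-Factors-≈ {h = Perm.id , k₁ , k₂} {h} ((λ i → ≡.sym (g≈id i)) , refl , refl)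
      (size-Factors-even-∉X k₁≉ε
        (λ k₁≈k₂ → h∉X (even-∈X⁺ h g≈id (inj₁ (k₁≈k₂ , k₁≉ε)))))
    where
    k₁≉ε : ¬ k₁ ≈ ε
    -- With k₁ = e_K, h would be the identity or lie in B, according to whether k₂ is e_K.
    k₁≉ε k₁≈ε with k₂ ≟ ε
    ... | yes k₂≈ε = h≉ε (g≈id , k₁≈ε , k₂≈ε)
    ... | no  k₂≉ε = h∉X (even-∈X⁺ h g≈id (inj₂ (k₁≈ε , k₂≉ε)))
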